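{- For every integer $k \geq 3$, the graphs $O_k = K_{2k} - kK_2$ and $\overline{C}_{2k+1}$ are nearly dispersable, with $$mbt(O_k, \phi_{2k}) = 2k-1 = mbt(\overline{C}_{2k+1}, \phi_{2k+1}),$$ where for $n\in\{2k,2k+1\}$, $\phi_n := (1, 2, \ldots, k, n, n-1, \ldots, k+1)$ is the folded cyclic order on $\{1,\ldots,n\}$.
   Context: All graphs are finite and simple. For a set $S=\{i_1<\cdots<i_s\}$ of integers with $s\ge 1$, $1\le i_1$ and $i_s\le \lfloor n/2\rfloor$, the circulant $C(n,S)$ is the graph on vertex set $\{1,\ldots,n\}$ in which each $j$ is adjacent to $j+i_r$ (addition mod $n$) for $r=1,\ldots,s$. $O_k$ is the cocktail party graph (1-skeleton of the octahedron), the complete graph $K_{2k}$ with a perfect matching removed; it is regular of degree $2k-2$. $\overline{C}_{2k+1}$ is the complement of a cycle of length $2k+1$, i.e. $K_{2k+1}$ with a spanning cycle removed. The vertices are labelled so that these are the circulants $O_k = C(2k,\{1,\ldots,k-1\})$ (the removed matching consists of the length-$k$ jumps $\{i,i+k\}$) and $\overline{C}_{2k+1}=C(2k+1,\{1,\ldots,k-1\})$ (the removed Hamiltonian cycle consists of the length-$k$ jumps $\{i,i+k\}$ mod $2k+1$). Given a graph $G$ and a cyclic order $\omega$ on $V(G)$, draw the vertices on a circle in the order $\omega$ and the edges as straight chords; two edges cross if they intersect at a point that is not an endpoint. A matching book embedding $(G,\omega,c)$ consists of $G$, a cyclic order $\omega$, and an edge-coloring $c$ (the color classes are the pages) such that any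 two distinct edges of the same color neither cross nor share an endpoint. The number $mbt(G,\omega)$ is the least number of colors in any matching book embedding $(G,\omega,c)$ with the given cyclic order $\omega$. An embedding is dispersable if the number of colors equals the maximum degree $\Delta(G)$, and nearly dispersable if the number of colors equals $1+\Delta(G)$. A graph is dispersable if it has a dispersable matching book embedding; it is nearly dispersable if it is not dispersable and has a nearly dispersable matching book embedding. -}

module Defs where

open import Data.Empty using (⊥-elim)
open import Data.Fin.Base using (Fin; toℕ; fromℕ<)
open import Data.Fin.Permutation using (Permutation′; permutation; _⟨$⟩ˡ_)
open import Data.Fin.Properties using (nonZeroIndex; toℕ<n; toℕ-injective; toℕ-fromℕ<)
import Data.Fin.Properties as Fin
open import Data.List.Base using (List; []; _∷_; length; filter; map; allFin)
open import Data.List.Extrema.Nat using (max)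
open import Data.List.Relation.Unary.Any using (Any; any?)
import Data.List.Relation.Unary.Any as Any
open import Data.Nat.Base
open import Data.Nat.DivMod using (_%_)
open import Data.Nat.Properties
open import Data.Product.Base using (_×_; _,_; ∃-syntax)
open import Data.Sum.Base using (_⊎_; swap)
open import Function.Base using (_∘_)
open import Level using (0ℓ)
open import Relation.Binary.Core using (Rel)
open import Relation.Binary.Definitions using (Decidable; Irreflexive; Symmetric)
open import Relation.Binary.PropositionalEquality
open import Relation.Nullary using (¬_; yes; no)
open import Relation.Nullary.Decidable using (_×-dec_; _⊎-dec_; ¬?)

-- The vertex called i ∈ {1,…,n} in the literature is the element of Fin n
-- with toℕ equal to i ∸ 1.

record Graph (n : ℕ) : Set₁ where
  field
    Adj    : Rel (Fin n) 0ℓ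
    sym-   : Symmetric Adj
    irrefl : Irreflexive _≡_ Adj
    adj?   : Decidable Adj

  degree : Fin n → ℕ
  degree u = length (filter (adj? u) (allFin n))

  Δ : ℕ
  Δ = max 0 (map degree (allFin n))

K : ∀ n → Graph n
K n = record
  { Adj    = _≢_
  ; sym-   = λ u≢v v≡u → u≢v (sym v≡u)
  ; irrefl = λ u≡v u≢v → u≢v u≡v
  ; adj?   = λ u v → ¬? (u Fin.≟ v)
  }

infixl 6 _∖_

_∖_ : ∀ {n} → Graph n → Graph n → Graph n
G ∖ H = record
  { Adj    = λ u v → G.Adj u v × ¬ H.Adj u v
  ; sym-   = λ (g , ¬h) → G.sym- g , λ h → ¬h (H.sym- h)
  ; irrefl = λ u≡v (g , _) → G.irrefl u≡v g
  ; adj?   = λ u v → G.adj? u v ×-dec ¬? (H.adj? u v)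
  }
  where
  module G = Graph G
  module H = Graph H

Jump : ∀ {n} → ℕ → Rel (Fin n) 0ℓ
Jump {n} s u v = toℕ v ≡ _%_ (toℕ u + s) n ⦃ nonZeroIndex u ⦄

-- For 1 ≤ s ≤ ⌊ n /2⌋ a jump never fixes a vertex, so u ≢ v is then automatic;
-- it makes the graph simple for an arbitrary list S.
circulant : ∀ n → List ℕ → Graph n
circulant n S = record
  { Adj    = λ u v → u ≢ v × Any (λ s → Jump s u v ⊎ Jump s v u) S
  ; sym-   = λ (u≢v , j) → u≢v ∘ sym , Any.map swap j
  ; irrefl = λ u≡v (u≢v , _) → u≢v u≡v
  ; adj?   = λ u v → ¬? (u Fin.≟ v) ×-dec
                     any? (λ s → (_ ≟ _) ⊎-dec (_ ≟ _)) S
  }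

-- K₂ₖ minus the perfect matching {i , i+k}.
O : ∀ k → Graph (2 * k)
O k = K (2 * k) ∖ circulant (2 * k) (k ∷ [])

-- K₂ₖ₊₁ minus the Hamiltonian cycle formed by the edges {i , i+k}.
C̅ : ∀ k → Graph (2 * k + 1)
C̅ k = K (2 * k + 1) ∖ circulant (2 * k + 1) (k ∷ [])

-- A cyclic order is represented by any of its linear cuts, as a bijection
-- ω from positions to vertices; Cross is invariant under rotating the positions.
CyclicOrder : ℕ → Set
CyclicOrder = Permutation′

position : ∀ {n} → CyclicOrder n → Fin n → ℕ
position ω v = toℕ (ω ⟨$⟩ˡ v)

-- Chords ab and cd of a circle meet in a non-endpoint exactly when their
-- (four distinct) ends alternate around the circle.
Interleave : (a b c d : ℕ) → Set
Interleave a b c d =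
    (a ⊓ b < c ⊓ d × c ⊓ d < a ⊔ b × a ⊔ b < c ⊔ d)
  ⊎ (c ⊓ d < a ⊓ b × a ⊓ b < c ⊔ d × c ⊔ d < a ⊔ b)

module _ {n : ℕ} where

  Cross : CyclicOrder n → (u v x y : Fin n) → Set
  Cross ω u v x y =
    Interleave (position ω u) (position ω v) (position ω x) (position ω y)

  SameEdge : (u v x y : Fin n) → Set
  SameEdge u v x y = (u ≡ x × v ≡ y) ⊎ (u ≡ y × v ≡ x)

  ShareEndpoint : (u v x y : Fin n) → Set
  ShareEndpoint u v x y = u ≡ x ⊎ u ≡ y ⊎ v ≡ x ⊎ v ≡ y

  -- The adjacency argument of color is irrelevant, so that together with
  -- color-sym the color depends on the unordered pair {u , v} only.
  record MatchingBookEmbedding (G : Graph n) (ω : CyclicOrder n) (m : ℕ) : Set where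
    open Graph G
    field
      color     : ∀ u v → .(Adj u v) → Fin m
      color-sym : ∀ u v .(e : Adj u v) → color u v e ≡ color v u (sym- e)
      proper    : ∀ {u v x y} (e : Adj u v) (f : Adj x y) →
                  ¬ SameEdge u v x y → color u v e ≡ color x y f →
                  ¬ Cross ω u v x y × ¬ ShareEndpoint u v x y

  mbt[_,_]≡_ : Graph n → CyclicOrder n → ℕ → Set
  mbt[ G , ω ]≡ m =
    MatchingBookEmbedding G ω m × (∀ l → MatchingBookEmbedding G ω l → m ≤ l)

  Dispersable : Graph n → Set
  Dispersable G = ∃[ ω ] MatchingBookEmbedding G ω (Graph.Δ G)

  NearlyDispersable : Graph n → Set
  NearlyDispersable G =
    ¬ Dispersable G × ∃[ ω ] MatchingBookEmbedding G ω (1 + Graph.Δ G)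

-- The folded order 1, …, k, n, n-1, …, k+1.  With 0-based positions and
-- vertices, position p holds vertex p if p < k, and vertex n - 1 - (p - k)
-- otherwise.
module _ (n k : ℕ) where

  fold : Fin n → Fin n
  fold p with toℕ p <? k
  ... | yes _   = p
  ... | no  p≮k = fromℕ< {n + k ∸ suc (toℕ p)} bound
    where
    bound : n + k ∸ suc (toℕ p) < n
    bound = begin-strict
      n + k ∸ suc (toℕ p)  ≤⟨ ∸-monoʳ-≤ (n + k) (s≤s (≮⇒≥ p≮k)) ⟩
      n + k ∸ suc k        ≡⟨ cong₂ _∸_ (+-comm n k) (+-comm 1 k) ⟩
      k + n ∸ (k + 1)      ≡⟨ [m+n]∸[m+o]≡n∸o k n 1 ⟩
      n ∸ 1                <⟨ ∸-monoʳ-< (s≤s z≤n) (≤-trans (s≤s z≤n) (toℕ<n p)) ⟩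
      n                    ∎
      where open ≤-Reasoning

  fold-< : ∀ p → toℕ p < k → fold p ≡ p
  fold-< p p<k with toℕ p <? k
  ... | yes _   = refl
  ... | no  p≮k = ⊥-elim (p≮k p<k)

  toℕ-fold-≥ : ∀ p → k ≤ toℕ p → toℕ (fold p) ≡ n + k ∸ suc (toℕ p)
  toℕ-fold-≥ p k≤p with toℕ p <? k
  ... | yes p<k = ⊥-elim (<⇒≱ p<k k≤p)
  ... | no  _   = toℕ-fromℕ< _

  fold-≥ : ∀ p → k ≤ toℕ p → k ≤ toℕ (fold p)
  fold-≥ p k≤p = begin
    k                    ≡⟨ m+n∸m≡n n k ⟨
    n + k ∸ n            ≤⟨ ∸-monoʳ-≤ (n + k) (toℕ<n p) ⟩
    n + k ∸ suc (toℕ p)  ≡⟨ toℕ-fold-≥ p k≤p ⟨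
    toℕ (fold p)         ∎
    where open ≤-Reasoning

  fold-involutive : ∀ p → fold (fold p) ≡ p
  fold-involutive p with toℕ p <? k in eq
  ... | yes p<k = fold-< p p<k
  ... | no  p≮k = toℕ-injective (begin
    toℕ (fold q)                           ≡⟨ toℕ-fold-≥ q (subst (k ≤_) (trans (toℕ-fold-≥ p k≤p) (sym (toℕ-fromℕ< _))) (fold-≥ p k≤p)) ⟩
    n + k ∸ suc (toℕ q)                    ≡⟨ cong (λ i → n + k ∸ suc i) (toℕ-fromℕ< _) ⟩
    n + k ∸ suc (n + k ∸ suc (toℕ p))      ≡⟨ cong (n + k ∸_) (+-∸-assoc 1 p<n+k) ⟨
    n + k ∸ (n + k ∸ toℕ p)                ≡⟨ m∸[m∸n]≡n (<⇒≤ p<n+k) ⟩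
    toℕ p                                  ∎)
    where
    open ≡-Reasoning
    q = fromℕ< _
    k≤p = ≮⇒≥ p≮k
    p<n+k : toℕ p < n + k
    p<n+k = ≤-trans (toℕ<n p) (m≤m+n n k)

  φ : CyclicOrder n
  φ = permutation fold fold fold-involutive fold-involutive

{-# OPTIONS --safe #-}
-- Lower bound.  In a d-regular graph with d pages every page is a perfect
-- matching.  A chord of a non-crossing perfect matching encloses an even number
-- of positions, so its ends have opposite parity: the number of vertices is even
-- and the graph is bipartite.  C̅ₖ has odd order and Oₖ contains a triangle.
--
-- Upper bound.  Chords whose positions, counted from 0, have equal sum mod n are parallel, which
-- gives n pages for Kₙ in any order.  In the folded order the removed jumps of
-- length k are exactly the chords with sum n - 1 (and, if n = 2k + 1, also n - 2),
-- so the remaining 2k - 1 pages suffice.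
module Submission where

open import Defs
open import Data.Fin.Base using (Fin; toℕ; fromℕ<; punchOut)
open import Data.Fin.Permutation using (_⟨$⟩ˡ_; _⟨$⟩ʳ_; inverseˡ; inverseʳ)
open import Data.Fin.Properties using (nonZeroIndex; toℕ<n; toℕ-injective; toℕ-fromℕ<;
  fromℕ<-injective; fromℕ<-cong; injective⇒≤; punchOut-injective; any?)
import Data.Fin.Properties as Fin
open import Data.List.Base using (List; []; _∷_; _++_; length; filter; lookup; map; allFin)
open import Data.List.Extrema.Nat using (max≤v⁺; v≤max⁺)
open import Data.List.Membership.Propositional using (_∈_)
open import Data.List.Membership.Propositional.Properties
  using (∈-allFin; ∈-filter⁺; ∈-filter⁻; ∈-lookup; ∈-++⁺ˡ; ∈-++⁺ʳ; ∈-map⁺)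
open import Data.List.Membership.Propositional.Properties.WithK using (unique∧set⇒bag)
open import Data.List.Properties using (length-++; length-tabulate)
open import Data.List.Relation.Binary.BagAndSetEquality using (∼bag⇒↭)
open import Data.List.Relation.Binary.Permutation.Propositional.Properties using (↭-length)
open import Data.List.Relation.Unary.All as All using (All; []; _∷_)
import Data.List.Relation.Unary.All.Properties as All
open import Data.List.Relation.Unary.AllPairs using ([]; _∷_)
open import Data.List.Relation.Unary.Any as Any using (here; there)
open import Data.List.Relation.Unary.Unique.Propositional using (Unique)
open import Data.List.Relation.Unary.Unique.Propositional.Properties
  using (allFin⁺; filter⁺; ++⁺)
open import Data.Nat.Base using (zero; suc; _<_; _⊓_; _⊔_; NonZero; z≤n; s≤s; parity)
open import Data.Nat using (ℕ; _≤_; _+_; _*_; _∸_)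
open import Data.Nat.DivMod
open import Data.Nat.Induction using (Acc; acc; <-wellFounded)
open import Data.Nat.Properties
open import Data.Parity.Base using (0ℙ; 1ℙ; _⁻¹)
import Data.Parity.Base as ℙ
import Data.Parity.Properties as ℙ
open import Data.Product using (_×_; _,_; proj₁; proj₂; ∃-syntax; Σ-syntax)
open import Data.Sum.Base using (_⊎_; inj₁; inj₂; [_,_]′)
open import Function.Base using (_∘_)
open import Function.Bundles using (mk⇔)
open import Function.Definitions using (Injective)
open import Level using (Level)
open import Relation.Binary.Definitions using (tri<; tri≈; tri>)
open import Relation.Binary.PropositionalEquality
open import Relation.Nullary using (¬_; yes; no; contradiction)
open import Relation.Nullary.Decidable using (_×-dec_; _⊎-dec_; decidable-stable)

private
  variable
    ℓ : Level
    A : Set ℓ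
    m n : ℕ

-- Injections between finite sets and duplicate-free lists.

injective⇒surjective : {f : Fin m → Fin n} → Injective _≡_ _≡_ f → n ≤ m →
                       ∀ c → ∃[ i ] f i ≡ c
injective⇒surjective {n = suc _} {f} f-inj n≤m c with any? (λ i → f i Fin.≟ c)
... | yes hit  = hit
-- Punching the missed value out of the codomain leaves an injection into a set with one element
-- fewer.
... | no  miss = contradiction (≤-trans n≤m (injective⇒≤ avoid-inj)) 1+n≰n
  where
  c≢f : ∀ i → c ≢ f i
  c≢f i c≡fi = miss (i , sym c≡fi)

  avoid-inj : Injective _≡_ _≡_ (λ i → punchOut (c≢f i))
  avoid-inj {i} {j} = f-inj ∘ punchOut-injective (c≢f i) (c≢f j)

lookup-injective : {xs : List A} → Unique xs → Injective _≡_ _≡_ (lookup xs)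
lookup-injective (_ ∷ _)  {Fin.zero}  {Fin.zero}  _  = refl
lookup-injective (x∉ ∷ _) {Fin.zero}  {Fin.suc j} eq =
  contradiction eq (All.lookup x∉ (∈-lookup j))
lookup-injective (x∉ ∷ _) {Fin.suc i} {Fin.zero}  eq =
  contradiction (sym eq) (All.lookup x∉ (∈-lookup i))
lookup-injective (_ ∷ u)  {Fin.suc i} {Fin.suc j} eq =
  cong Fin.suc (lookup-injective u eq)

-- Interleaving chords

interleave-right : ∀ {a b c d} → a < c → c < b → b < d → Interleave a b c d
interleave-right a<c c<b b<d
  rewrite m≤n⇒m⊓n≡m (<⇒≤ (<-trans a<c c<b)) | m≤n⇒m⊔n≡n (<⇒≤ (<-trans a<c c<b))
        | m≤n⇒m⊓n≡m (<⇒≤ (<-trans c<b b<d)) | m≤n⇒m⊔n≡n (<⇒≤ (<-trans c<b b<d))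
  = inj₁ (a<c , c<b , b<d)

interleave-left : ∀ {a b c d} → d < a → a < c → c < b → Interleave a b c d
interleave-left d<a a<c c<b
  rewrite m≤n⇒m⊓n≡m (<⇒≤ (<-trans a<c c<b)) | m≤n⇒m⊔n≡n (<⇒≤ (<-trans a<c c<b))
        | m≥n⇒m⊓n≡n (<⇒≤ (<-trans d<a a<c)) | m≥n⇒m⊔n≡m (<⇒≤ (<-trans d<a a<c))
  = inj₂ (d<a , a<c , c<b)

interleave-irrefl : ∀ {a b} → ¬ Interleave a b a b
interleave-irrefl (inj₁ (lt , _)) = <-irrefl refl lt
interleave-irrefl (inj₂ (lt , _)) = <-irrefl refl lt

interleave-flip : ∀ {a b} → ¬ Interleave a b b a
interleave-flip {a} {b} (inj₁ (lt , _)) = <-irrefl (⊓-comm a b) lt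
interleave-flip {a} {b} (inj₂ (lt , _)) = <-irrefl (⊓-comm b a) lt

⊓+⊔ : ∀ a b → a ⊓ b + (a ⊔ b) ≡ a + b
⊓+⊔ a b with ≤-total a b
... | inj₁ a≤b rewrite m≤n⇒m⊓n≡m a≤b | m≤n⇒m⊔n≡n a≤b = refl
... | inj₂ b≤a rewrite m≥n⇒m⊓n≡n b≤a | m≥n⇒m⊔n≡m b≤a = +-comm b a

-- Non-crossing perfect matchings

module _ (g : Fin n → Fin n) (g-involutive : ∀ p → g (g p) ≡ p) (g-free : ∀ p → g p ≢ p)
         (noncrossing : ∀ p q → ¬ Interleave (toℕ p) (toℕ (g p)) (toℕ q) (toℕ (g q)))
         where

  -- The matching `g` restricts to the half-open interval from `a` to `b`. This is the invariant for
  -- an induction on the length of the interval.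
  Closed : ℕ → ℕ → Set
  Closed a b = ∀ p → a ≤ toℕ p → toℕ p < b → a ≤ toℕ (g p) × toℕ (g p) < b

  g-swap : ∀ {p q} → toℕ (g q) ≡ toℕ p → toℕ q ≡ toℕ (g p)
  g-swap {p} {q} eq =
    cong toℕ (trans (sym (g-involutive q)) (cong g (toℕ-injective eq)))

  -- A mate outside the chord would make a crossing, and a mate at one end of the chord would put
  -- `q` at the other end. If `g p` lies to the left of `p`, the interval is empty.
  under-chord : ∀ p → Closed (suc (toℕ p)) (toℕ (g p))
  under-chord p q p<q q<gp = ≰⇒> gq≰p , ≰⇒> gp≰gq
    where
    gq≰p : ¬ toℕ (g q) ≤ toℕ p
    gq≰p gq≤p with m≤n⇒m<n∨m≡n gq≤p
    ... | inj₁ gq<p = noncrossing p q (interleave-left gq<p p<q q<gp)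
    ... | inj₂ gq≡p = <⇒≢ q<gp (g-swap gq≡p)

    gp≰gq : ¬ toℕ (g p) ≤ toℕ (g q)
    gp≰gq gp≤gq with m≤n⇒m<n∨m≡n gp≤gq
    ... | inj₁ gp<gq = noncrossing p q (interleave-right p<q q<gp gp<gq)
    ... | inj₂ gp≡gq = <⇒≢ p<q (trans (g-swap {g q} {p} gp≡gq) (cong toℕ (g-involutive q)))

  -- The chord at the left end splits a closed interval into two shorter ones.
  closed-even′ : ∀ {l} → Acc _<_ l → ∀ a → a + l ≤ n → Closed a (a + l) → parity l ≡ 0ℙ
  closed-even′ {zero}  _        a _     _      = refl
  closed-even′ {suc l} (acc rs) a a+l≤n closed = begin
    parity (suc l)          ≡⟨ cong parity 1+l≡2+i+j ⟩
    parity (i + j)          ≡⟨ ℙ.+-homo-+ i j ⟩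
    parity i ℙ.+ parity j   ≡⟨ cong₂ ℙ._+_ i-even j-even ⟩
    0ℙ                      ∎
    where
    open ≡-Reasoning
    b = a + suc l
    a<b : a < b
    a<b = m<m+n a (s≤s z≤n)
    a<n = ≤-trans a<b a+l≤n
    p = fromℕ< a<n
    p≡a : toℕ p ≡ a
    p≡a = toℕ-fromℕ< a<n
    c = toℕ (g p)
    a≤c×c<b = closed p (≤-reflexive (sym p≡a)) (subst (_< b) (sym p≡a) a<b)
    c<b = proj₂ a≤c×c<b
    a<c : a < c
    a<c = ≤∧≢⇒< (proj₁ a≤c×c<b) λ a≡c → g-free p (toℕ-injective (trans (sym a≡c) (sym p≡a)))
    -- `i` counts the positions strictly between `a` and its mate `c`, and `j` those after `c` and
    -- before `b`; the chord itself takes the remaining two.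
    i = proj₁ (m≤n⇒∃[o]m+o≡n a<c)
    j = proj₁ (m≤n⇒∃[o]m+o≡n c<b)
    1+a+i≡c : suc a + i ≡ c
    1+a+i≡c = proj₂ (m≤n⇒∃[o]m+o≡n a<c)
    1+c+j≡b : suc c + j ≡ b
    1+c+j≡b = proj₂ (m≤n⇒∃[o]m+o≡n c<b)

    1+l≡2+i+j : suc l ≡ 2 + (i + j)
    1+l≡2+i+j = +-cancelˡ-≡ a _ _ (begin
      a + suc l            ≡⟨ 1+c+j≡b ⟨
      suc c + j            ≡⟨ cong (λ x → suc x + j) 1+a+i≡c ⟨
      2 + (a + i + j)      ≡⟨ cong (2 +_) (+-assoc a i j) ⟩
      2 + (a + (i + j))    ≡⟨ cong suc (+-suc a (i + j)) ⟨
      suc (a + suc (i + j))≡⟨ +-suc a (suc (i + j)) ⟨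
      a + (2 + (i + j))    ∎)

    i-even = closed-even′ (rs (subst (i <_) (sym 1+l≡2+i+j) (s≤s (m≤n⇒m≤1+n (m≤m+n i j)))))
      (suc a) (≤-trans (≤-reflexive 1+a+i≡c) (<⇒≤ (toℕ<n (g p))))
      (subst₂ Closed (cong suc p≡a) (sym 1+a+i≡c) (under-chord p))

    beyond : Closed (suc c) b
    beyond q c<q q<b = ≰⇒> gq≰c , proj₂ (closed q (<⇒≤ (<-trans a<c c<q)) q<b)
      where
      a≤gq : a ≤ toℕ (g q)
      a≤gq = proj₁ (closed q (<⇒≤ (<-trans a<c c<q)) q<b)

      gq≰c : ¬ toℕ (g q) ≤ c
      gq≰c gq≤c with m≤n⇒m<n∨m≡n gq≤c | m≤n⇒m<n∨m≡n a≤gq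
      -- A mate at `a` means that `q` is `c`, a mate at `c` means that `q` is `a`, and a mate
      -- strictly under the chord forces `q` under it as well.
      ... | _ | inj₂ a≡gq = <⇒≢ c<q (sym (g-swap (trans (sym a≡gq) (sym p≡a))))
      ... | inj₂ gq≡c | _ = <⇒≢ (<-trans a<c c<q)
              (trans (sym p≡a) (trans (cong toℕ (sym (g-involutive p))) (sym (g-swap gq≡c))))
      ... | inj₁ gq<c | inj₁ a<gq = <-asym c<q (subst (λ x → toℕ x < c) (g-involutive q)
              (proj₂ (under-chord p (g q) (subst (_< toℕ (g q)) (sym p≡a) a<gq) gq<c)))

    j-even = closed-even′ (rs (subst (j <_) (sym 1+l≡2+i+j) (s≤s (m≤n⇒m≤1+n (m≤n+m j i)))))
      (suc c) (≤-trans (≤-reflexive 1+c+j≡b) a+l≤n) (subst (Closed (suc c)) (sym 1+c+j≡b) beyond)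

  closed-even : ∀ {a l} → a + l ≤ n → Closed a (a + l) → parity l ≡ 0ℙ
  closed-even = closed-even′ (<-wellFounded _) _

  order-even : parity n ≡ 0ℙ
  order-even = closed-even {0} ≤-refl λ p _ _ → z≤n , toℕ<n (g p)

  -- The `i` positions under the chord form a closed interval, so `i` is even and the right end
  -- `1 + p + i` has the other parity.
  chord-parity-< : ∀ p → toℕ p < toℕ (g p) → parity (toℕ p) ≢ parity (toℕ (g p))
  chord-parity-< p p<gp eq with i , 1+p+i≡gp ← m≤n⇒∃[o]m+o≡n p<gp =
    ℙ.p≢p⁻¹ (parity (toℕ p)) (begin
      parity (toℕ p)                         ≡⟨ eq ⟩
      parity (toℕ (g p))                     ≡⟨ cong parity 1+p+i≡gp ⟨
      parity (suc (toℕ p) + i)               ≡⟨ ℙ.+-homo-+ (suc (toℕ p)) i ⟩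
      parity (suc (toℕ p)) ℙ.+ parity i      ≡⟨ cong (parity (suc (toℕ p)) ℙ.+_) i-even ⟩
      parity (suc (toℕ p)) ℙ.+ 0ℙ            ≡⟨ ℙ.+-identityʳ _ ⟩
      parity (suc (toℕ p))                   ≡⟨ ℙ.⁻¹-selfInverse (ℙ.suc-homo-⁻¹ (toℕ p)) ⟨
      parity (toℕ p) ⁻¹                      ∎)
    where
    open ≡-Reasoning
    i-even : parity i ≡ 0ℙ
    i-even = closed-even (≤-trans (≤-reflexive 1+p+i≡gp) (<⇒≤ (toℕ<n (g p))))
      (subst (Closed (suc (toℕ p))) (sym 1+p+i≡gp) (under-chord p))

  chord-parity : ∀ p → parity (toℕ p) ≢ parity (toℕ (g p))
  chord-parity p with <-cmp (toℕ p) (toℕ (g p))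
  ... | tri< p<gp _ _ = chord-parity-< p p<gp
  ... | tri≈ _ p≡gp _ = contradiction (toℕ-injective (sym p≡gp)) (g-free p)
  ... | tri> _ _ gp<p = λ eq → chord-parity-< (g p)
    (subst (toℕ (g p) <_) (cong toℕ (sym (g-involutive p))) gp<p)
    (trans (sym eq) (cong (parity ∘ toℕ) (sym (g-involutive p))))

-- Embeddings with as many pages as the degree

-- The inequality `m ≤ degree` lets one argument refute every page count up to the degree, as
-- minimality in `mbt` demands.
module FullPages {G : Graph n} {ω : CyclicOrder n} (E : MatchingBookEmbedding G ω m)
                 (m≤degree : ∀ u → m ≤ Graph.degree G u) where
  open Graph G
  open MatchingBookEmbedding E

  share⇒same : ∀ {u v x y} (e : Adj u v) (f : Adj x y) → color u v e ≡ color x y f →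
               ShareEndpoint u v x y → SameEdge u v x y
  share⇒same {u} {v} {x} {y} e f same-color share = decidable-stable
    ((u Fin.≟ x ×-dec v Fin.≟ y) ⊎-dec (u Fin.≟ y ×-dec v Fin.≟ x))
    λ differ → proj₂ (proper e f differ same-color) share

  same-color-neighbour : ∀ {u v w} (e : Adj u v) (f : Adj u w) →
                         color u v e ≡ color u w f → v ≡ w
  same-color-neighbour e f same-color with share⇒same e f same-color (inj₁ refl)
  ... | inj₁ (_ , v≡w) = v≡w
  ... | inj₂ (u≡w , _) = contradiction f (irrefl u≡w)

  module _ (u : Fin n) where
    neighbours : List (Fin n)
    neighbours = filter (adj? u) (allFin n)

    neighbour-adj : ∀ i → Adj u (lookup neighbours i)
    neighbour-adj i = proj₂ (∈-filter⁻ (adj? u) {xs = allFin n} (∈-lookup i))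

    -- Edges at `u` have distinct colors and there are at least `m` of them, so each of the `m`
    -- colors occurs at `u`.
    color-surjective : ∀ c → ∃[ v ] Σ[ e ∈ Adj u v ] color u v e ≡ c
    color-surjective c
      with i , hit ← injective⇒surjective
        (λ {i} {j} → lookup-injective (filter⁺ (adj? u) (allFin⁺ n))
                   ∘ same-color-neighbour (neighbour-adj i) (neighbour-adj j))
        (m≤degree u) c
      = lookup neighbours i , neighbour-adj i , hit

  module Page (c : Fin m) where
    mate : Fin n → Fin n
    mate u = proj₁ (color-surjective u c)

    mate-adj : ∀ u → Adj u (mate u)
    mate-adj u = proj₁ (proj₂ (color-surjective u c))

    mate-color : ∀ u → color u (mate u) (mate-adj u) ≡ c
    mate-color u = proj₂ (proj₂ (color-surjective u c))

    mate-involutive : ∀ u → mate (mate u) ≡ u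
    mate-involutive u = same-color-neighbour (mate-adj (mate u)) (sym- (mate-adj u))
      (trans (mate-color (mate u))
        (trans (sym (mate-color u)) (color-sym u (mate u) (mate-adj u))))

    -- `proper` speaks of distinct edges only. If `u` is `v` or `mate v`, both edges are the same
    -- chord, which does not interleave with itself.
    mate-noncrossing : ∀ u v → ¬ Cross ω u (mate u) v (mate v)
    mate-noncrossing u v cross with u Fin.≟ v | u Fin.≟ mate v
    ... | yes refl | _        = interleave-irrefl cross
    ... | no _     | yes u≡mv = interleave-flip (subst
      (λ w → Interleave (position ω u) (position ω (mate u)) (position ω w) (position ω u))
      (trans (sym (mate-involutive v)) (cong mate (sym u≡mv)))
      (subst (λ w → Interleave (position ω u) (position ω (mate u)) (position ω v) (position ω w))
        (sym u≡mv) cross))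
    ... | no u≢v   | no u≢mv  = proj₁
      (proper (mate-adj u) (mate-adj v)
        [ u≢v ∘ proj₁ , u≢mv ∘ proj₁ ]′
        (trans (mate-color u) (sym (mate-color v))))
      cross

    -- The page transported from vertices to positions, where the results on non-crossing perfect
    -- matchings apply.
    g : Fin n → Fin n
    g p = ω ⟨$⟩ˡ mate (ω ⟨$⟩ʳ p)

    g-involutive : ∀ p → g (g p) ≡ p
    g-involutive p = trans (cong (λ u → ω ⟨$⟩ˡ mate u) (inverseʳ ω))
      (trans (cong (ω ⟨$⟩ˡ_) (mate-involutive _)) (inverseˡ ω))

    g-free : ∀ p → g p ≢ p
    g-free p gp≡p = irrefl
      (trans (cong (ω ⟨$⟩ʳ_) (sym gp≡p)) (inverseʳ ω)) (mate-adj (ω ⟨$⟩ʳ p))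

    g-noncrossing : ∀ p q → ¬ Interleave (toℕ p) (toℕ (g p)) (toℕ q) (toℕ (g q))
    g-noncrossing p q = mate-noncrossing (ω ⟨$⟩ʳ p) (ω ⟨$⟩ʳ q) ∘ subst₂
      (λ p′ q′ → Interleave (toℕ p′) (toℕ (g p)) (toℕ q′) (toℕ (g q)))
      (sym (inverseˡ ω)) (sym (inverseˡ ω))

  -- The edge provides a color, hence a page that matches all `n` positions.
  edge⇒order-even : ∀ {u v} → Adj u v → parity n ≡ 0ℙ
  edge⇒order-even {u} {v} e = order-even P.g P.g-involutive P.g-free P.g-noncrossing
    where module P = Page (color u v e)

  -- In the page of its own color, the edge is the chord of the matching at `u`.
  edge-parity : ∀ {u v} → Adj u v → parity (position ω u) ≢ parity (position ω v)
  edge-parity {u} {v} e =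
    subst (λ w → parity (position ω u) ≢ parity (position ω w)) mate≡v
      (subst (λ w → parity (position ω u) ≢ parity (position ω (P.mate w))) (inverseʳ ω)
        (chord-parity P.g P.g-involutive P.g-free P.g-noncrossing (ω ⟨$⟩ˡ u)))
    where
    module P = Page (color u v e)
    mate≡v : P.mate u ≡ v
    mate≡v = same-color-neighbour (P.mate-adj u) e (P.mate-color u)

  -- Three pairwise different parities would be required, and there are only two.
  no-triangle : ∀ {u v w} → Adj u v → Adj v w → ¬ Adj u w
  no-triangle {u} {v} {w} uv vw uw =
    pigeon (parity (position ω u)) (parity (position ω v)) (parity (position ω w))
      (edge-parity uv) (edge-parity vw) (edge-parity uw)
    where
    pigeon : ∀ x y z → x ≢ y → y ≢ z → ¬ x ≢ z
    pigeon 0ℙ 0ℙ _  x≢y _ _ = x≢y refl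
    pigeon 1ℙ 1ℙ _  x≢y _ _ = x≢y refl
    pigeon 0ℙ 1ℙ 0ℙ _ _ x≢z = x≢z refl
    pigeon 0ℙ 1ℙ 1ℙ _ y≢z _ = y≢z refl
    pigeon 1ℙ 0ℙ 0ℙ _ y≢z _ = y≢z refl
    pigeon 1ℙ 0ℙ 1ℙ _ _ x≢z = x≢z refl

-- Degree counting and regular graphs.

module _ (G : Graph n) where
  open Graph G

  -- Degrees are computed through the few non-neighbours, `u` among them. Duplicate-free lists with
  -- the same elements are permutations of each other, hence equally long.
  degree+nonneighbours : ∀ u xs → Unique xs → (∀ {v} → v ∈ xs → ¬ Adj u v) →
                         (∀ {v} → ¬ Adj u v → v ∈ xs) → length xs + degree u ≡ n
  degree+nonneighbours u xs xs! xs⇒¬adj ¬adj⇒xs = begin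
    length xs + degree u  ≡⟨ length-++ xs ⟨
    length (xs ++ ns)     ≡⟨ ↭-length (∼bag⇒↭ (unique∧set⇒bag xs++ns! (allFin⁺ n)
                               (λ {v} → mk⇔ (λ _ → ∈-allFin v) (λ _ → split v)))) ⟩
    length (allFin n)     ≡⟨ length-tabulate {n = n} (λ i → i) ⟩
    n                     ∎
    where
    open ≡-Reasoning
    ns = filter (adj? u) (allFin n)
    xs++ns! : Unique (xs ++ ns)
    xs++ns! = ++⁺ xs! (filter⁺ (adj? u) (allFin⁺ n))
      λ (v∈xs , v∈ns) → xs⇒¬adj v∈xs (proj₂ (∈-filter⁻ (adj? u) {xs = allFin n} v∈ns))
    split : ∀ v → v ∈ xs ++ ns
    split v with adj? u v
    ... | yes uv = ∈-++⁺ʳ xs (∈-filter⁺ (adj? u) (∈-allFin v) uv)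
    ... | no ¬uv = ∈-++⁺ˡ (¬adj⇒xs ¬uv)

  regular⇒Δ : ∀ {d} → Fin n → (∀ u → degree u ≡ d) → Δ ≡ d
  regular⇒Δ {d} v regular = ≤-antisym
    (max≤v⁺ {xs = map degree (allFin n)} z≤n
      (All.map⁺ (All.tabulate λ {u} _ → ≤-reflexive (regular u))))
    (v≤max⁺ 0 _ (inj₂ (Any.map (λ { refl → ≤-reflexive (sym (regular v)) })
      (∈-map⁺ degree (∈-allFin v)))))

  -- Excluding all page counts up to `d` in every order yields both non-dispersability and the
  -- minimality of `suc d` for `ω`.
  regular⇒nearly-dispersable :
    ∀ {d} ω → Fin n → (∀ u → degree u ≡ d) →
    (∀ ω′ l → l ≤ d → ¬ MatchingBookEmbedding G ω′ l) →
    MatchingBookEmbedding G ω (suc d) →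
    NearlyDispersable G × mbt[ G , ω ]≡ suc d
  regular⇒nearly-dispersable {d} ω v regular few embedding =
    ( (λ (ω′ , E) → few ω′ Δ (≤-reflexive Δ≡d) E)
    , ω , subst (MatchingBookEmbedding G ω ∘ suc) (sym Δ≡d) embedding )
    , embedding , λ l E → ≰⇒> λ l≤d → few ω l l≤d E
    where
    Δ≡d : Δ ≡ d
    Δ≡d = regular⇒Δ v regular

-- Sums modulo n

module _ .⦃ _ : NonZero n ⦄ where
  open ≡-Reasoning

  %-absorbˡ : ∀ a b → (a % n + b) % n ≡ (a + b) % n
  %-absorbˡ a b = begin
    (a % n + b) % n           ≡⟨ %-distribˡ-+ (a % n) b n ⟩
    (a % n % n + b % n) % n   ≡⟨ cong (λ x → (x + b % n) % n) (m%n%n≡m%n a n) ⟩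
    (a % n + b % n) % n       ≡⟨ %-distribˡ-+ a b n ⟨
    (a + b) % n               ∎

  -- `n ∸ a % n` serves as the negative of `a` modulo `n`.
  +-%-undo : ∀ a {b} → b < n → ((a + b) % n + (n ∸ a % n)) % n ≡ b
  +-%-undo a {b} b<n = begin
    ((a + b) % n + (n ∸ r)) % n   ≡⟨ %-absorbˡ (a + b) (n ∸ r) ⟩
    (a + b + (n ∸ r)) % n         ≡⟨ cong (_% n) (+-assoc a b (n ∸ r)) ⟩
    (a + (b + (n ∸ r))) % n       ≡⟨ %-absorbˡ a (b + (n ∸ r)) ⟨
    (r + (b + (n ∸ r))) % n       ≡⟨ cong (_% n) (+-comm r _) ⟩
    (b + (n ∸ r) + r) % n         ≡⟨ cong (_% n) (+-assoc b (n ∸ r) r) ⟩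
    (b + (n ∸ r + r)) % n         ≡⟨ cong (λ x → (b + x) % n) (m∸n+n≡m (m%n≤n a n)) ⟩
    (b + n) % n                   ≡⟨ [m+n]%n≡m%n b n ⟩
    b % n                         ≡⟨ m<n⇒m%n≡m b<n ⟩
    b                             ∎
    where r = a % n

  +-%-cancelˡ : ∀ a {b c} → b < n → c < n → (a + b) % n ≡ (a + c) % n → b ≡ c
  +-%-cancelˡ a {b} {c} b<n c<n eq = begin
    b                                   ≡⟨ +-%-undo a b<n ⟨
    ((a + b) % n + (n ∸ a % n)) % n     ≡⟨ cong (λ x → (x + (n ∸ a % n)) % n) eq ⟩
    ((a + c) % n + (n ∸ a % n)) % n     ≡⟨ +-%-undo a c<n ⟩
    c                                   ∎

  +-%-cancelʳ : ∀ a {b c} → b < n → c < n → (b + a) % n ≡ (c + a) % n → b ≡ c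
  +-%-cancelʳ a {b} {c} b<n c<n eq =
    +-%-cancelˡ a b<n c<n (trans (cong (_% n) (+-comm a b)) (trans eq (cong (_% n) (+-comm c a))))

  -- Two crossing chords have sums that differ by less than n, and not by 0.
  equal-sum⇒¬alternate : ∀ {a b c d} → (a + b) % n ≡ (c + d) % n →
                          a < c → c < b → b < d → ¬ d < n
  equal-sum⇒¬alternate {a} {b} {c} {d} eq a<c c<b b<d d<n
    with t , 1+a+b+t≡c+d ← m≤n⇒∃[o]m+o≡n (+-mono-< a<c b<d)
    = contradiction
        (+-%-cancelˡ (a + b) (≤-trans (s≤s z≤n) d<n) 1+t<n
          (trans (cong (_% n) (+-identityʳ (a + b))) (trans eq (cong (_% n) c+d≡))))
        λ ()
    where
    c+d≡ : c + d ≡ a + b + suc t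
    c+d≡ = trans (sym 1+a+b+t≡c+d) (sym (+-suc (a + b) t))
    -- From `c < b` and `d < n` it follows that `c + d < a + b + n`.
    1+t<n : suc t < n
    1+t<n = +-cancelˡ-< (a + b) _ _ (subst (_< a + b + n) c+d≡
      (+-mono-≤-< (≤-trans (<⇒≤ c<b) (m≤n+m b a)) d<n))

  -- Sorting the ends of a chord preserves their sum, which reduces both forms of interleaving to
  -- `equal-sum⇒¬alternate`.
  equal-sum⇒¬Interleave : ∀ {a b c d} → a < n → b < n → c < n → d < n →
                           (a + b) % n ≡ (c + d) % n → ¬ Interleave a b c d
  equal-sum⇒¬Interleave {a} {b} {c} {d} a<n b<n c<n d<n eq =
    [ (λ (p , q , r) → equal-sum⇒¬alternate eq′ p q r (⊔-pres-<m c<n d<n))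
    , (λ (p , q , r) → equal-sum⇒¬alternate (sym eq′) p q r (⊔-pres-<m a<n b<n)) ]′
    where
    eq′ : (a ⊓ b + (a ⊔ b)) % n ≡ (c ⊓ d + (c ⊔ d)) % n
    eq′ = trans (cong (_% n) (⊓+⊔ a b)) (trans eq (sym (cong (_% n) (⊓+⊔ c d))))

  -- A sum that wraps past `n` and leaves at least `m` would be at least `m + n`, but
  -- `a ≤ n - 2 ≤ m` and `b < n`.
  sum-near-n : ∀ {a b} → a < b → b < n → n ≤ 2 + m → m ≤ (a + b) % n → a + b < n × m ≤ a + b
  sum-near-n {m} {a} {b} a<b b<n n≤2+m m≤sum%n with ≤-<-connex n (a + b)
  ... | inj₂ a+b<n = a+b<n , ≤-trans m≤sum%n (m%n≤m (a + b) n)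
  ... | inj₁ n≤a+b with t , n+t≡a+b ← m≤n⇒∃[o]m+o≡n n≤a+b =
    contradiction (+-mono-≤-< a≤m b<n) (≤⇒≯ m+n≤a+b)
    where
    a≤m : a ≤ m
    a≤m = ≤-pred (≤-pred (≤-trans (s≤s a<b) (≤-trans b<n n≤2+m)))
    m≤t : m ≤ t
    m≤t = ≤-trans m≤sum%n (≤-trans (≤-reflexive (begin
      (a + b) % n   ≡⟨ cong (_% n) n+t≡a+b ⟨
      (n + t) % n   ≡⟨ cong (_% n) (+-comm n t) ⟩
      (t + n) % n   ≡⟨ [m+n]%n≡m%n t n ⟩
      t % n         ∎)) (m%n≤m t n))
    m+n≤a+b : m + n ≤ a + b
    m+n≤a+b = ≤-trans (+-monoˡ-≤ n m≤t) (≤-reflexive (trans (+-comm t n) n+t≡a+b))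

-- Pages of parallel chords.

position-injective : ∀ (ω : CyclicOrder n) {u v} → position ω u ≡ position ω v → u ≡ v
position-injective ω {u} {v} eq = begin
  u                       ≡⟨ inverseʳ ω ⟨
  ω ⟨$⟩ʳ (ω ⟨$⟩ˡ u)   ≡⟨ cong (ω ⟨$⟩ʳ_) (toℕ-injective eq) ⟩
  ω ⟨$⟩ʳ (ω ⟨$⟩ˡ v)   ≡⟨ inverseʳ ω ⟩
  v                       ∎
  where open ≡-Reasoning

parallel-pages : .⦃ _ : NonZero n ⦄ (G : Graph n) (ω : CyclicOrder n) →
  (∀ {u v} → Graph.Adj G u v → (position ω u + position ω v) % n < m) →
  MatchingBookEmbedding G ω m
parallel-pages {n} G ω bound = record
  { color     = λ u v e → fromℕ< (bound e)
  ; color-sym = λ u v e → fromℕ<-cong _ _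
      (cong (_% n) (+-comm (position ω u) (position ω v))) (bound e) (bound (sym- e))
  ; proper    = λ {u} {v} {x} {y} e f differ same-color →
      let same-sum = fromℕ<-injective _ _ (bound e) (bound f) same-color in
        equal-sum⇒¬Interleave (pos<n u) (pos<n v) (pos<n x) (pos<n y) same-sum
      -- A shared end cancels from the equal sums, so the other ends coincide and the edges are the
      -- same.
      , λ { (inj₁ refl)               → differ (inj₁ (refl , position-injective ω
              (+-%-cancelˡ (position ω u) (pos<n v) (pos<n y) same-sum)))
          ; (inj₂ (inj₁ refl))        → differ (inj₂ (refl , position-injective ω
              (+-%-cancelˡ (position ω u) (pos<n v) (pos<n x)
                (trans same-sum (cong (_% n) (+-comm (position ω x) (position ω u)))))))
          ; (inj₂ (inj₂ (inj₁ refl))) → differ (inj₂ (position-injective ω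
              (+-%-cancelʳ (position ω v) (pos<n u) (pos<n y)
                (trans same-sum (cong (_% n) (+-comm (position ω v) (position ω y))))) , refl))
          ; (inj₂ (inj₂ (inj₂ refl))) → differ (inj₁ (position-injective ω
              (+-%-cancelʳ (position ω v) (pos<n u) (pos<n x) same-sum) , refl)) }
  }
  where
  open Graph G
  pos<n : ∀ u → position ω u < n
  pos<n u = toℕ<n (ω ⟨$⟩ˡ u)

-- Complete graphs without the jumps of one length

rotate : ℕ → Fin n → Fin n
rotate {n} s u = fromℕ< (m%n<n (toℕ u + s) n ⦃ nonZeroIndex u ⦄)

jump⇒rotate : ∀ s (u : Fin n) {v} → Jump s u v → v ≡ rotate s u
jump⇒rotate s u jump = toℕ-injective (trans jump (sym (toℕ-fromℕ< _)))

rotate-jump : ∀ s (u : Fin n) → Jump s u (rotate s u)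
rotate-jump s u = toℕ-fromℕ< _

rotate-0 : ∀ (u : Fin n) → rotate 0 u ≡ u
rotate-0 {n} u = sym (jump⇒rotate 0 u
  (sym (trans (cong (λ x → _%_ x n ⦃ nonZeroIndex u ⦄) (+-identityʳ (toℕ u)))
              (m<n⇒m%n≡m ⦃ nonZeroIndex u ⦄ (toℕ<n u)))))

rotate-distinct : ∀ {s t} {u : Fin n} → s < n → t < n → s ≢ t → rotate s u ≢ rotate t u
rotate-distinct {s = s} {t} {u} s<n t<n s≢t eq =
  s≢t (+-%-cancelˡ ⦃ nonZeroIndex u ⦄ (toℕ u) s<n t<n (fromℕ<-injective _ _ _ _ eq))

-- Going back by `s` is going forward by `t` modulo `n = s + t`.
jump-reverse : ∀ {s t} {u v : Fin n} → n ≡ s + t → Jump s v u → Jump t u v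
jump-reverse {n} {s} {t} {u} {v} n≡s+t jump = begin
  toℕ v                     ≡⟨ m<n⇒m%n≡m (toℕ<n v) ⟨
  toℕ v % n                 ≡⟨ [m+n]%n≡m%n (toℕ v) n ⟨
  (toℕ v + n) % n           ≡⟨ cong (λ x → (toℕ v + x) % n) n≡s+t ⟩
  (toℕ v + (s + t)) % n     ≡⟨ cong (_% n) (+-assoc (toℕ v) s t) ⟨
  (toℕ v + s + t) % n       ≡⟨ %-absorbˡ (toℕ v + s) t ⟨
  ((toℕ v + s) % n + t) % n ≡⟨ cong (λ x → (x + t) % n) u≡v+s ⟨
  (toℕ u + t) % n           ∎
  where
  open ≡-Reasoning
  instance _ = nonZeroIndex u
  u≡v+s : toℕ u ≡ (toℕ v + s) % n
  u≡v+s = jump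

module _ {n k : ℕ} where
  private
    G = K n ∖ circulant n (k ∷ [])
  open Graph G

  ¬jump⇒adj : ∀ {u v} → u ≢ v → ¬ Jump k u v → ¬ Jump k v u → Adj u v
  ¬jump⇒adj u≢v ¬uv ¬vu = u≢v , λ { (_ , here jump) → [ ¬uv , ¬vu ]′ jump }

  adj⇒¬jump : ∀ {u v} → Adj u v → ¬ Jump k u v
  adj⇒¬jump (u≢v , ¬circ) jump = ¬circ (u≢v , here (inj₁ jump))

  -- A jump of length `k` from below `k` does not wrap and lands at `k` or beyond. This supplies the
  -- triangle in `O k` and an edge of `C̅ k`.
  near⇒adj : k + k ≤ n → ∀ {u v} → u ≢ v → toℕ u < k → toℕ v < k → Adj u v
  near⇒adj 2k≤n u≢v u<k v<k = ¬jump⇒adj u≢v (no-jump u<k v<k) (no-jump v<k u<k)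
    where
    no-jump : ∀ {u v} → toℕ u < k → toℕ v < k → ¬ Jump k u v
    no-jump {u} u<k v<k jump = <⇒≱ v<k (≤-trans (m≤n+m k (toℕ u)) (≤-reflexive (sym
      (trans jump (m<n⇒m%n≡m ⦃ nonZeroIndex u ⦄ (≤-trans (+-monoˡ-< k u<k) 2k≤n))))))

  -- `k′` is the backward jump: the non-neighbours of `u` are `u`, `u + k` and `u - k = u + k′`
  -- modulo `n`.
  module _ {k′} (n≡k+k′ : n ≡ k + k′) where

    rotate-0-¬adj : ∀ u → ¬ Adj u (rotate 0 u)
    rotate-0-¬adj u = irrefl (sym (rotate-0 u))

    rotate-k-¬adj : ∀ u → ¬ Adj u (rotate k u)
    rotate-k-¬adj u e = adj⇒¬jump e (rotate-jump k u)

    rotate-k′-¬adj : ∀ u → ¬ Adj u (rotate k′ u)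
    rotate-k′-¬adj u e = adj⇒¬jump (sym- e)
      (jump-reverse (trans n≡k+k′ (+-comm k k′)) (rotate-jump k′ u))

    ¬adj⇒rotate : ∀ {u v} → ¬ Adj u v → v ≡ rotate 0 u ⊎ v ≡ rotate k u ⊎ v ≡ rotate k′ u
    ¬adj⇒rotate {u} {v} ¬uv with u Fin.≟ v | v Fin.≟ rotate k u | v Fin.≟ rotate k′ u
    ... | yes refl | _       | _       = inj₁ (sym (rotate-0 u))
    ... | no _     | yes v≡k | _       = inj₂ (inj₁ v≡k)
    ... | no _     | no _    | yes v≡k′ = inj₂ (inj₂ v≡k′)
    ... | no u≢v   | no v≢k  | no v≢k′ = contradiction
      (¬jump⇒adj u≢v (v≢k ∘ jump⇒rotate k u) (v≢k′ ∘ jump⇒rotate k′ u ∘ jump-reverse n≡k+k′)) ¬uv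

  -- The forward and the backward jump coincide here, which leaves two non-neighbours.
  degree-even-order : 1 ≤ k → n ≡ k + k → ∀ u → 2 + degree u ≡ n
  degree-even-order 1≤k n≡k+k u = degree+nonneighbours G u (rotate 0 u ∷ rotate k u ∷ [])
    ((rotate-distinct (≤-trans 1≤k k≤n) k<n (<⇒≢ 1≤k) ∷ []) ∷ [] ∷ [])
    (λ { (here refl)         → rotate-0-¬adj n≡k+k u
       ; (there (here refl)) → rotate-k-¬adj n≡k+k u })
    (λ ¬uv → [ here , there ∘ here ∘ [ (λ eq → eq) , (λ eq → eq) ]′ ]′
      (¬adj⇒rotate n≡k+k ¬uv))
    where
    k<n = subst (k <_) (sym n≡k+k) (m<m+n k 1≤k)
    k≤n = <⇒≤ k<n

  degree-odd-order : 1 ≤ k → n ≡ k + suc k → ∀ u → 3 + degree u ≡ n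
  degree-odd-order 1≤k n≡k+1+k u =
    degree+nonneighbours G u (rotate 0 u ∷ rotate k u ∷ rotate (suc k) u ∷ [])
    ( (rotate-distinct 0<n k<n (<⇒≢ 1≤k) ∷ rotate-distinct 0<n 1+k<n (λ ()) ∷ [])
    ∷ (rotate-distinct k<n 1+k<n (<⇒≢ (n<1+n k)) ∷ [])
    ∷ [] ∷ [])
    (λ { (here refl)                 → rotate-0-¬adj n≡k+1+k u
       ; (there (here refl))         → rotate-k-¬adj n≡k+1+k u
       ; (there (there (here refl))) → rotate-k′-¬adj n≡k+1+k u })
    (λ ¬uv → [ here , there ∘ [ here , there ∘ here ]′ ]′ (¬adj⇒rotate n≡k+1+k ¬uv))
    where
    1+k<n = subst (suc k <_) (sym n≡k+1+k) (m<n+m (suc k) 1≤k)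
    k<n = <⇒≤ 1+k<n
    0<n = ≤-trans (s≤s z≤n) k<n

  -- The folded order

  private
    pos : Fin n → ℕ
    pos = position (φ n k)

  pos<k⇒toℕ : ∀ {u} → pos u < k → toℕ u ≡ pos u
  pos<k⇒toℕ {u} pos<k =
    cong toℕ (trans (sym (fold-involutive n k u)) (fold-< n k (fold n k u) pos<k))

  pos≥k⇒toℕ : ∀ {u} → k ≤ pos u → toℕ u ≡ n + k ∸ suc (pos u)
  pos≥k⇒toℕ {u} k≤pos =
    trans (cong toℕ (sym (fold-involutive n k u))) (toℕ-fold-≥ n k (fold n k u) k≤pos)

  -- On the reversed half, position `b = n - 1 - a` holds vertex `n + k - 1 - b = a + k`.
  sum-n∸1⇒jump : ∀ {u v} → pos u < k → k ≤ pos v → 1 + (pos u + pos v) ≡ n → Jump k u v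
  sum-n∸1⇒jump {u} {v} a<k k≤b 1+a+b≡n =
    trans v≡u+k (sym (m<n⇒m%n≡m ⦃ nonZeroIndex u ⦄ (subst (_< n) v≡u+k (toℕ<n v))))
    where
    open ≡-Reasoning
    a = pos u
    b = pos v
    v≡u+k : toℕ v ≡ toℕ u + k
    v≡u+k = begin
      toℕ v                     ≡⟨ pos≥k⇒toℕ k≤b ⟩
      n + k ∸ suc b             ≡⟨ cong (λ x → x + k ∸ suc b) 1+a+b≡n ⟨
      a + b + k ∸ b             ≡⟨ cong (λ x → x + k ∸ b) (+-comm a b) ⟩
      b + a + k ∸ b             ≡⟨ cong (_∸ b) (+-assoc b a k) ⟩
      b + (a + k) ∸ b           ≡⟨ m+n∸m≡n b (a + k) ⟩
      a + k                     ≡⟨ cong (_+ k) (pos<k⇒toℕ a<k) ⟨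
      toℕ u + k                 ∎

  -- Position `b = n - 2 - a` holds vertex `a + k + 1`, and a further jump of `k` gives
  -- `a + 2k + 1 = a + n`, so the jump leads from `v` back to `u`.
  sum-n∸2⇒jump : ∀ {u v} → pos u < k → k ≤ pos v → 2 + (pos u + pos v) ≡ n →
                 n ≡ suc (k + k) → Jump k v u
  sum-n∸2⇒jump {u} {v} a<k k≤b 2+a+b≡n n≡1+2k = begin
    toℕ u                     ≡⟨ m<n⇒m%n≡m (toℕ<n u) ⟨
    toℕ u % n                 ≡⟨ [m+n]%n≡m%n (toℕ u) n ⟨
    (toℕ u + n) % n           ≡⟨ cong (_% n) v+k≡u+n ⟨
    (toℕ v + k) % n           ∎
    where
    open ≡-Reasoning
    instance _ = nonZeroIndex v
    a = pos u
    b = pos v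
    v+k≡u+n : toℕ v + k ≡ toℕ u + n
    v+k≡u+n = begin
      toℕ v + k                       ≡⟨ cong (_+ k) (pos≥k⇒toℕ k≤b) ⟩
      n + k ∸ suc b + k               ≡⟨ cong (λ x → x + k ∸ suc b + k) 2+a+b≡n ⟨
      suc (a + b) + k ∸ b + k         ≡⟨ cong (λ x → suc x + k ∸ b + k) (+-comm a b) ⟩
      suc (b + a) + k ∸ b + k         ≡⟨ cong (λ x → x + k ∸ b + k) (+-suc b a) ⟨
      b + suc a + k ∸ b + k           ≡⟨ cong (λ x → x ∸ b + k) (+-assoc b (suc a) k) ⟩
      b + (suc a + k) ∸ b + k         ≡⟨ cong (_+ k) (m+n∸m≡n b (suc a + k)) ⟩
      suc (a + k + k)                 ≡⟨ cong suc (+-assoc a k k) ⟩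
      suc (a + (k + k))               ≡⟨ +-suc a (k + k) ⟨
      a + suc (k + k)                 ≡⟨ cong₂ _+_ (pos<k⇒toℕ a<k) n≡1+2k ⟨
      toℕ u + n                       ∎

  -- Here `m = 2k - 1`, and `n ≤ 2 + m` admits both `n = 2k` and `n = 2k + 1`.
  module _ ⦃ _ : NonZero n ⦄ {m} (1+m≡2k : 1 + m ≡ k + k) (n≤2+m : n ≤ 2 + m) where

    folded-sum-< : ∀ {u v} → pos u < pos v → Adj u v → (pos u + pos v) % n < m
    folded-sum-< {u} {v} a<b e = ≰⇒> impossible
      where
      a = pos u
      b = pos v
      module _ (a+b<n : a + b < n) (m≤a+b : m ≤ a + b) where
        -- The chord joins the two halves: ends in the same half have a sum of at least `2k + 1 ≥ n`
        -- or at most `2k - 2 < m`.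
        a<k : a < k
        a<k = ≰⇒> λ k≤a → <⇒≱ a+b<n (≤-trans n≤2+m
          (subst (λ x → suc x ≤ a + b) (sym 1+m≡2k) (+-mono-≤-< k≤a (≤-<-trans k≤a a<b))))
        k≤b : k ≤ b
        k≤b = ≮⇒≥ λ b<k → <-irrefl 1+m≡2k
          (≤-trans (s≤s (s≤s m≤a+b)) (≤-trans (≤-reflexive (sym (cong suc (+-suc a b))))
            (+-mono-≤ (<-trans a<b b<k) b<k)))

      impossible : ¬ m ≤ (a + b) % n
      impossible m≤sum%n
        with a+b<n , m≤a+b ← sum-near-n a<b (toℕ<n (φ n k ⟨$⟩ˡ v)) n≤2+m m≤sum%n
        with m≤n⇒m<n∨m≡n a+b<n
      ... | inj₂ 1+a+b≡n = adj⇒¬jump e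
        (sum-n∸1⇒jump {u} {v} (a<k a+b<n m≤a+b) (k≤b a+b<n m≤a+b) 1+a+b≡n)
      -- Now `m ≤ a + b ≤ n - 2 ≤ m`, which forces the sum `n - 2` and `n = 2k + 1`.
      ... | inj₁ 1+a+b<n = adj⇒¬jump (sym- e)
        (sum-n∸2⇒jump {u} {v} (a<k a+b<n m≤a+b) (k≤b a+b<n m≤a+b)
          (≤-antisym 1+a+b<n (≤-trans n≤2+m (s≤s (s≤s m≤a+b))))
          (trans (≤-antisym n≤2+m (≤-trans (s≤s (s≤s m≤a+b)) 1+a+b<n)) (cong suc 1+m≡2k)))

    folded-pages : MatchingBookEmbedding G (φ n k) m
    folded-pages = parallel-pages _ (φ n k) bound
      where
      bound : ∀ {u v} → Adj u v → (pos u + pos v) % n < m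
      bound {u} {v} e with <-cmp (pos u) (pos v)
      ... | tri< a<b _ _ = folded-sum-< {u} {v} a<b e
      ... | tri≈ _ a≡b _ = contradiction e (irrefl (position-injective (φ n k) a≡b))
      ... | tri> _ _ b<a = subst (λ x → x % n < m) (+-comm (pos v) (pos u))
        (folded-sum-< {v} {u} b<a (sym- e))

-- Cocktail party graphs and complements of odd cycles.

theorem8 : (k : ℕ) → 3 ≤ k →
    NearlyDispersable (O k) ×
    NearlyDispersable (C̅ k) ×
    mbt[ O k , φ (2 * k) k ]≡ (2 * k ∸ 1) ×
    mbt[ C̅ k , φ (2 * k + 1) k ]≡ (2 * k ∸ 1)
-- Three exposed successors provide the vertices 0, 1, 2 below `k` and let `suc (2 * k ∸ 2)` and
-- `2 * k ∸ 1` reduce to the same term.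
theorem8 k@(suc (suc (suc _))) (s≤s (s≤s (s≤s _))) =
  proj₁ O-result , proj₁ C̅-result , proj₂ O-result , proj₂ C̅-result
  where
  2k≡k+k : 2 * k ≡ k + k
  2k≡k+k = cong (k +_) (+-identityʳ k)

  2k+1≡k+1+k : 2 * k + 1 ≡ k + suc k
  2k+1≡k+1+k = trans (+-comm (2 * k) 1) (trans (cong suc 2k≡k+k) (sym (+-suc k k)))

  O-degree : ∀ u → Graph.degree (O k) u ≡ 2 * k ∸ 2
  O-degree u = +-cancelˡ-≡ 2 _ _ (degree-even-order (s≤s z≤n) 2k≡k+k u)

  C̅-degree : ∀ u → Graph.degree (C̅ k) u ≡ 2 * k ∸ 2
  C̅-degree u = +-cancelˡ-≡ 3 _ _
    (trans (degree-odd-order (s≤s z≤n) 2k+1≡k+1+k u) (+-comm (2 * k) 1))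

  O-near : ∀ {u v} → u ≢ v → toℕ u < k → toℕ v < k → Graph.Adj (O k) u v
  O-near = near⇒adj (≤-reflexive (sym 2k≡k+k))

  O-result = regular⇒nearly-dispersable (O k) (φ (2 * k) k) Fin.zero O-degree
    (λ ω l l≤Δ E → FullPages.no-triangle E
      (λ u → ≤-trans l≤Δ (≤-reflexive (sym (O-degree u))))
      (O-near {Fin.zero} {Fin.suc Fin.zero} (λ ()) (s≤s z≤n) (s≤s (s≤s z≤n)))
      (O-near {_} {Fin.suc (Fin.suc Fin.zero)} (λ ()) (s≤s (s≤s z≤n)) (s≤s (s≤s (s≤s z≤n))))
      (O-near (λ ()) (s≤s z≤n) (s≤s (s≤s (s≤s z≤n)))))
    (folded-pages 2k≡k+k (n≤1+n (2 * k)))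

  2k+1-odd : parity (2 * k + 1) ≢ 0ℙ
  2k+1-odd even with () ← trans (sym (trans (ℙ.+-homo-+ (2 * k) 1)
    (cong (ℙ._+ 1ℙ) (ℙ.*-homo-* 2 k)))) even

  C̅-result = regular⇒nearly-dispersable (C̅ k) (φ (2 * k + 1) k) Fin.zero C̅-degree
    (λ ω l l≤Δ E → 2k+1-odd (FullPages.edge⇒order-even E
      (λ u → ≤-trans l≤Δ (≤-reflexive (sym (C̅-degree u))))
      (near⇒adj (subst (_≤ 2 * k + 1) 2k≡k+k (m≤m+n (2 * k) 1))
        {Fin.zero} {Fin.suc Fin.zero} (λ ()) (s≤s z≤n) (s≤s (s≤s z≤n)))))
    (folded-pages 2k≡k+k (≤-reflexive (+-comm (2 * k) 1)))
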